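{- Let $\mathbf{Ax}'$ be the set of axiom schemas consisting of $\alpha\to\neg\neg\alpha$; $(\circ\alpha\vee\circ\beta)\leftrightarrow\circ(\alpha\wedge\beta)$; $(\circ\alpha\vee\circ\beta)\leftrightarrow\circ(\alpha\vee\beta)$; $(\circ\alpha\vee\circ\beta)\leftrightarrow\circ(\alpha\to\beta)$. Then $$\mathbb{K}_{\mathbf{Ciore}}=\{\mathcal{B}\in\mathbb{K}_{\mathbf{Ci}}:\mathcal{M}(\mathcal{B})\text{ validates all the axioms in }\mathbf{Ax}'\}.$$
   Context: Let $\Sigma=\{\wedge,\vee,\to,\neg,\circ\}$ ($\neg,\circ$ unary, the others binary); $For(\Sigma)$ is the set of formulas over $\Sigma$ generated by a denumerable set of propositional variables, and $\alpha\leftrightarrow\beta$ abbreviates $(\alpha\to\beta)\wedge(\beta\to\alpha)$. A multialgebra over $\Sigma$ is a nonempty set with operations whose values are nonempty subsets. Elements of swap structures are here pairs. For a Boolean algebra $\mathcal{A}$ with domain $A$ (the one-element Boolean algebra is allowed), complement $\sim$, a swap structure for $\mathbf{Ci}$ over $\mathcal{A}$ is a multialgebra $\mathcal{B}$ over $\Sigma$ with domain $|\mathcal{B}|=B\subseteq\{(z_1,z_2)\in A^2:z_1\vee z_2=1\}$ such that $0\in\{z_1:z\in B\}$ and for all $z,w\in B$: $\emptyset\ne z\#w\subseteq\{u\in B:u_1=z_1\#w_1\}$ for $\#\in\{\wedge,\vee,\to\}$; $\emptyset\ne\neg z\subseteq\{u\in B:u_1=z_2\text{ and }u_2\le z_1\}$;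 $\circ z=\{({\sim}(z_1\wedge z_2),z_1\wedge z_2)\}$. $\mathbb{K}_{\mathbf{Ci}}$ is the class of all of these over arbitrary Boolean algebras. $\mathbb{K}_{\mathbf{Ciore}}$ is the class of those $\mathcal{B}\in\mathbb{K}_{\mathbf{Ci}}$ whose multioperations are single-valued and given by $z\#w=\{(z_1\#w_1,\ (z_1\#w_1)\to((z_1\wedge z_2)\wedge(w_1\wedge w_2)))\}$ for $\#\in\{\wedge,\vee,\to\}$, $\neg z=\{(z_2,z_1)\}$, $\circ z=\{({\sim}(z_1\wedge z_2),z_1\wedge z_2)\}$ for all $z,w\in B$. $\mathcal{M}(\mathcal{B})=(\mathcal{B},D_{\mathcal{B}})$ is the Nmatrix with designated set $D_{\mathcal{B}}=\{z\in B:z_1=1\}$. A valuation over $\mathcal{M}(\mathcal{B})$ is $v:For(\Sigma)\to B$ with $v(\alpha\#\beta)\in v(\alpha)\#v(\beta)$, $v(\neg\alpha)\in\neg v(\alpha)$, $v(\circ\alpha)\in\circ v(\alpha)$. $\mathcal{M}(\mathcal{B})$ validates an axiom schema if $v(\gamma)\in D_{\mathcal{B}}$ for every instance $\gamma$ and every valuation $v$. -}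

module Defs where

open import Level using (Level; _⊔_; suc; 0ℓ)
open import Algebra.Core using (Op₂)
open import Algebra.Lattice.Bundles using (BooleanAlgebra)
import Algebra.Lattice.Properties.BooleanAlgebra as BooleanAlgebraProperties
open import Data.Nat.Base using (ℕ)
open import Data.Product.Base using (Σ; Σ-syntax; _×_; _,_; proj₁; proj₂)
open import Data.Product.Relation.Binary.Pointwise.NonDependent using (×-setoid)
open import Relation.Binary.Bundles using (Setoid; Poset)
open import Relation.Binary.Definitions using (_Respects_)
import Relation.Binary.Construct.On as On
open import Relation.Unary using (Pred; _∈_; _⊆_; _≐_; _∩_; Satisfiable)

private
  variable
    a c ℓ r s : Level

data BinOp : Set where
  and or imp : BinOp

data UnOp : Set where
  neg circ : UnOp

data Formula : Set where
  var : ℕ → Formula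
  bin : BinOp → Formula → Formula → Formula
  un  : UnOp → Formula → Formula

infix  9 ¬ᶠ_ ∘ᶠ_
infixr 7 _∧ᶠ_
infixr 6 _∨ᶠ_
infixr 5 _→ᶠ_
infix  4 _↔ᶠ_

pattern _∧ᶠ_ α β = bin and α β
pattern _∨ᶠ_ α β = bin or α β
pattern _→ᶠ_ α β = bin imp α β
pattern ¬ᶠ_ α = un neg α
pattern ∘ᶠ_ α = un circ α

_↔ᶠ_ : Formula → Formula → Formula
α ↔ᶠ β = (α →ᶠ β) ∧ᶠ (β →ᶠ α)

-- Domains are setoids, because the Boolean algebras of the library carry their
-- own equality; subsets of a domain are predicates respecting that equality,
-- and multioperations send equal arguments to equal subsets.
record Multialgebra (S : Setoid a ℓ) (s : Level) : Set (a ⊔ ℓ ⊔ suc s) where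
  open Setoid S
  field
    nonempty     : Carrier
    bin⟦_⟧       : BinOp → Carrier → Carrier → Pred Carrier s
    un⟦_⟧        : UnOp → Carrier → Pred Carrier s
    bin-nonempty : ∀ # x y → Satisfiable (bin⟦ # ⟧ x y)
    un-nonempty  : ∀ # x → Satisfiable (un⟦ # ⟧ x)
    bin-cong     : ∀ # {x x′ y y′} → x ≈ x′ → y ≈ y′ → bin⟦ # ⟧ x y ≐ bin⟦ # ⟧ x′ y′
    un-cong      : ∀ # {x x′} → x ≈ x′ → un⟦ # ⟧ x ≐ un⟦ # ⟧ x′
    bin-resp     : ∀ # x y → bin⟦ # ⟧ x y Respects _≈_
    un-resp      : ∀ # x → un⟦ # ⟧ x Respects _≈_

record Nmatrix {S : Setoid a ℓ} (M : Multialgebra S s) (r : Level)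
               : Set (a ⊔ ℓ ⊔ suc r) where
  open Setoid S
  field
    Designated      : Pred Carrier r
    designated-resp : Designated Respects _≈_

module _ {S : Setoid a ℓ} {M : Multialgebra S s} where
  open Setoid S using (Carrier)
  open Multialgebra M

  record Valuation (N : Nmatrix M r) : Set (a ⊔ s) where
    field
      val     : Formula → Carrier
      val-bin : ∀ # α β → val (bin # α β) ∈ bin⟦ # ⟧ (val α) (val β)
      val-un  : ∀ # α → val (un # α) ∈ un⟦ # ⟧ (val α)

  -- A schema is given by the set of its instances.
  Validates : Nmatrix M r → Pred Formula 0ℓ → Set (a ⊔ r ⊔ s)
  Validates N schema =
    ∀ γ → γ ∈ schema → (v : Valuation N) → Valuation.val v γ ∈ Nmatrix.Designated N

data Ax′ : Set where
  ax-¬¬ ax-∧ ax-∨ ax-→ : Ax′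

data Instance : Ax′ → Pred Formula 0ℓ where
  inst-¬¬ : ∀ α → Instance ax-¬¬ (α →ᶠ ¬ᶠ ¬ᶠ α)
  inst-∧  : ∀ α β → Instance ax-∧ ((∘ᶠ α ∨ᶠ ∘ᶠ β) ↔ᶠ ∘ᶠ (α ∧ᶠ β))
  inst-∨  : ∀ α β → Instance ax-∨ ((∘ᶠ α ∨ᶠ ∘ᶠ β) ↔ᶠ ∘ᶠ (α ∨ᶠ β))
  inst-→  : ∀ α β → Instance ax-→ ((∘ᶠ α ∨ᶠ ∘ᶠ β) ↔ᶠ ∘ᶠ (α →ᶠ β))

module Boolean (𝒜 : BooleanAlgebra c ℓ) where
  open BooleanAlgebra 𝒜 public renaming (¬_ to ∼_; Carrier to A)
  -- x ≤ y is x ≈ x ∧ y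
  open Poset (BooleanAlgebraProperties.poset 𝒜) public using (_≤_)

  infixr 5 _⇒_
  _⇒_ : Op₂ A
  x ⇒ y = (∼ x) ∨ y

  op : BinOp → Op₂ A
  op and = _∧_
  op or  = _∨_
  op imp = _⇒_

  pairSetoid : Setoid c ℓ
  pairSetoid = ×-setoid setoid setoid

-- A Boolean algebra 𝒜 together with a multialgebra whose domain is a subset of A².
record PairMultialgebra (c ℓ r s : Level) : Set (suc (c ⊔ ℓ ⊔ r ⊔ s)) where
  field
    𝒜 : BooleanAlgebra c ℓ
  open Boolean 𝒜 public
  field
    Dom      : Pred (A × A) r
    Dom-resp : Dom Respects (Setoid._≈_ pairSetoid)

  domain : Setoid (c ⊔ r) ℓ
  domain = On.setoid {B = Σ (A × A) Dom} pairSetoid proj₁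

  field
    multialgebra : Multialgebra domain s

  open Multialgebra multialgebra public

  B : Set (c ⊔ r)
  B = Setoid.Carrier domain

  fst snd : B → A
  fst z = proj₁ (proj₁ z)
  snd z = proj₂ (proj₁ z)

  -- The subset {p} of B. A set of the form z # w is nonempty, so z # w ≐ ⟪ p ⟫
  -- also entails p ∈ Dom, by Dom-resp.
  ⟪_⟫ : A × A → Pred B ℓ
  ⟪ p ⟫ u = Setoid._≈_ pairSetoid (proj₁ u) p

  nmatrix : Nmatrix multialgebra ℓ
  nmatrix = record
    { Designated      = λ z → fst z ≈ ⊤
    ; designated-resp = λ z≈w z≈⊤ → trans (sym (proj₁ z≈w)) z≈⊤
    }

record IsCi (𝓑 : PairMultialgebra c ℓ r s) : Set (c ⊔ ℓ ⊔ r ⊔ s) where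
  open PairMultialgebra 𝓑
  field
    dom-⊤   : ∀ (z : B) → fst z ∨ snd z ≈ ⊤
    dom-⊥   : Σ[ z ∈ B ] fst z ≈ ⊥
    bin-val : ∀ # z w → bin⟦ # ⟧ z w ⊆ λ u → fst u ≈ op # (fst z) (fst w)
    neg-val : ∀ z → un⟦ neg ⟧ z ⊆ λ u → fst u ≈ snd z × snd u ≤ fst z
    circ-val : ∀ z → un⟦ circ ⟧ z ≐ ⟪ ∼ (fst z ∧ snd z) , fst z ∧ snd z ⟫

record HasCioreOperations (𝓑 : PairMultialgebra c ℓ r s) : Set (c ⊔ ℓ ⊔ r ⊔ s) where
  open PairMultialgebra 𝓑
  field
    bin-det  : ∀ # z w →
      bin⟦ # ⟧ z w ≐ ⟪ op # (fst z) (fst w)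
                     , (op # (fst z) (fst w) ⇒ ((fst z ∧ snd z) ∧ (fst w ∧ snd w))) ⟫
    neg-det  : ∀ z → un⟦ neg ⟧ z ≐ ⟪ snd z , fst z ⟫
    circ-det : ∀ z → un⟦ circ ⟧ z ≐ ⟪ ∼ (fst z ∧ snd z) , fst z ∧ snd z ⟫

𝕂Ci : Pred (PairMultialgebra c ℓ r s) (c ⊔ ℓ ⊔ r ⊔ s)
𝕂Ci = IsCi

𝕂Ciore : Pred (PairMultialgebra c ℓ r s) (c ⊔ ℓ ⊔ r ⊔ s)
𝕂Ciore = 𝕂Ci ∩ HasCioreOperations

ValidatesAx′ : Pred (PairMultialgebra c ℓ r s) (c ⊔ ℓ ⊔ r ⊔ s)
ValidatesAx′ 𝓑 = ∀ ax → Validates (PairMultialgebra.nmatrix 𝓑) (Instance ax)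

{-# OPTIONS --safe #-}
module Submission where

-- Call fst z ∧ snd z the inconsistency of z. Whatever the choices made by a valuation,
-- (∘ α ∨ ∘ β) ↔ ∘ γ is designated exactly when the inconsistency of γ is the meet of
-- those of α and β, and α → ¬ ¬ α exactly when fst α ≤ fst (¬ ¬ α). Now a pair u with
-- fst u ∨ snd u ≈ ⊤ is determined by fst u and its inconsistency, since
-- snd u ≈ fst u ⇒ (fst u ∧ snd u). Hence validity of the schemas for connectives leaves
-- a single element in each z # w, provided every u ∈ z # w is the value of p₀ # p₁ under
-- some valuation sending p₀, p₁ to z, w; likewise for ¬.

open import Defs
open import Level using (Level)
open import Algebra.Lattice.Bundles using (BooleanAlgebra)
import Algebra.Lattice.Properties.BooleanAlgebra as BooleanAlgebraProperties
open import Data.Nat.Base using (ℕ; zero; suc)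
open import Data.Product.Base using (Σ-syntax; _×_; _,_; proj₁; proj₂)
open import Function.Bundles using (_⇔_; mk⇔; module Equivalence)
open import Function.Construct.Composition using (_⇔-∘_)
open import Relation.Binary.Bundles using (Setoid)
open import Relation.Binary.Definitions using (_Respects_)
import Relation.Binary.Lattice as OrderTheoretic
import Relation.Binary.Reasoning.Setoid as SetoidReasoning
open import Relation.Binary.PropositionalEquality.Core as ≡ using (_≡_)
open import Relation.Unary using (Pred; _∈_; _⊆_; _≐_; Satisfiable)

open Equivalence using (to; from)

private
  variable
    c ℓ r s : Level

-- Boolean identities relating implication, order and meet.

module BooleanLemmas (𝒜 : BooleanAlgebra c ℓ) where
  open Boolean 𝒜
  open BooleanAlgebraProperties 𝒜
    using ( ∧-identityʳ; ∧-identityˡ; ∨-identityˡ; deMorgan₁; ¬-involutive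
          ; ∨-∧-orderTheoreticLattice)
  open OrderTheoretic.Lattice ∨-∧-orderTheoreticLattice public
    using (x∧y≤x; x∧y≤y; ∧-greatest; x≤x∨y; y≤x∨y; antisym)
    renaming (refl to ≤-refl; reflexive to ≤-reflexive; trans to ≤-trans)
  open SetoidReasoning setoid

  ≈-⇔ : ∀ {x x′ y y′} → x ≈ x′ → y ≈ y′ → x ≈ y ⇔ x′ ≈ y′
  ≈-⇔ x≈x′ y≈y′ = mk⇔
    (λ x≈y → trans (sym x≈x′) (trans x≈y y≈y′))
    (λ x′≈y′ → trans x≈x′ (trans x′≈y′ (sym y≈y′)))

  ∼-injective : ∀ {x y} → ∼ x ≈ ∼ y → x ≈ y
  ∼-injective {x} {y} ∼x≈∼y = begin
    x      ≈⟨ ¬-involutive x ⟨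
    ∼ ∼ x  ≈⟨ ¬-cong ∼x≈∼y ⟩
    ∼ ∼ y  ≈⟨ ¬-involutive y ⟩
    y      ∎

  ∧-⇒ : ∀ x y → x ∧ (x ⇒ y) ≈ x ∧ y
  ∧-⇒ x y = begin
    x ∧ (∼ x ∨ y)      ≈⟨ ∧-distribˡ-∨ x (∼ x) y ⟩
    x ∧ ∼ x ∨ x ∧ y    ≈⟨ ∨-congʳ (∧-complementʳ x) ⟩
    ⊥ ∨ x ∧ y          ≈⟨ ∨-identityˡ _ ⟩
    x ∧ y              ∎

  ⇒-∧ : ∀ x y → x ⇒ (x ∧ y) ≈ x ⇒ y
  ⇒-∧ x y = begin
    ∼ x ∨ x ∧ y            ≈⟨ ∨-distribˡ-∧ (∼ x) x y ⟩
    (∼ x ∨ x) ∧ (∼ x ∨ y)  ≈⟨ ∧-congʳ (∨-complementˡ x) ⟩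
    ⊤ ∧ (∼ x ∨ y)          ≈⟨ ∧-identityˡ _ ⟩
    ∼ x ∨ y                ∎

  ⇒-⊤⇔≤ : ∀ {x y} → x ⇒ y ≈ ⊤ ⇔ x ≤ y
  ⇒-⊤⇔≤ {x} {y} = mk⇔
    (λ x⇒y≈⊤ → begin
      x            ≈⟨ ∧-identityʳ x ⟨
      x ∧ ⊤        ≈⟨ ∧-congˡ x⇒y≈⊤ ⟨
      x ∧ (x ⇒ y)  ≈⟨ ∧-⇒ x y ⟩
      x ∧ y        ∎)
    (λ x≤y → begin
      x ⇒ y        ≈⟨ ⇒-∧ x y ⟨
      x ⇒ (x ∧ y)  ≈⟨ ∨-congˡ x≤y ⟨
      ∼ x ∨ x      ≈⟨ ∨-complementˡ x ⟩
      ⊤            ∎)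

  ∧-⊤⇔ : ∀ {x y} → x ∧ y ≈ ⊤ ⇔ (x ≈ ⊤ × y ≈ ⊤)
  ∧-⊤⇔ {x} {y} = mk⇔
    (λ x∧y≈⊤ → above (x∧y≤x x y) x∧y≈⊤ , above (x∧y≤y x y) x∧y≈⊤)
    (λ (x≈⊤ , y≈⊤) → trans (∧-cong x≈⊤ y≈⊤) (∧-identityʳ ⊤))
    where
    above : ∀ {x y} → x ≤ y → x ≈ ⊤ → y ≈ ⊤
    above {x} {y} x≤y x≈⊤ = begin
      y      ≈⟨ ∧-identityˡ y ⟨
      ⊤ ∧ y  ≈⟨ ∧-congʳ x≈⊤ ⟨
      x ∧ y  ≈⟨ x≤y ⟨
      x      ≈⟨ x≈⊤ ⟩
      ⊤      ∎

  biconditional-⊤⇔≈ : ∀ {x y} → (x ⇒ y) ∧ (y ⇒ x) ≈ ⊤ ⇔ x ≈ y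
  biconditional-⊤⇔≈ = mk⇔
    (λ eq → let x⇒y≈⊤ , y⇒x≈⊤ = to ∧-⊤⇔ eq in
      antisym (to ⇒-⊤⇔≤ x⇒y≈⊤) (to ⇒-⊤⇔≤ y⇒x≈⊤))
    (λ x≈y → from ∧-⊤⇔
      (from ⇒-⊤⇔≤ (≤-reflexive x≈y) , from ⇒-⊤⇔≤ (≤-reflexive (sym x≈y))))

  -- Joining `x ∧ ∼ x` to `y` changes nothing, and distributing gives `(x ∨ y) ∧ (x ⇒ y)`, whose
  -- first factor is `⊤`.
  ∨≈⊤⇒snd-determined : ∀ {x y} → x ∨ y ≈ ⊤ → y ≈ x ⇒ (x ∧ y)
  ∨≈⊤⇒snd-determined {x} {y} x∨y≈⊤ = begin
    y                      ≈⟨ ∨-identityˡ y ⟨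
    ⊥ ∨ y                  ≈⟨ ∨-congʳ (∧-complementʳ x) ⟨
    x ∧ ∼ x ∨ y            ≈⟨ ∨-distribʳ-∧ y x (∼ x) ⟩
    (x ∨ y) ∧ (∼ x ∨ y)    ≈⟨ ∧-congʳ x∨y≈⊤ ⟩
    ⊤ ∧ (x ⇒ y)            ≈⟨ ∧-identityˡ _ ⟩
    x ⇒ y                  ≈⟨ ⇒-∧ x y ⟨
    x ⇒ (x ∧ y)            ∎

  ∼-∨-∼≈∼⇔ : ∀ {x y z} → ∼ x ∨ ∼ y ≈ ∼ z ⇔ x ∧ y ≈ z
  ∼-∨-∼≈∼⇔ {x} {y} = mk⇔
    (λ eq → ∼-injective (trans (deMorgan₁ x y) eq))
    (λ eq → trans (sym (deMorgan₁ x y)) (¬-cong eq))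

  ∧≤op : ∀ # x y → x ∧ y ≤ op # x y
  ∧≤op and x y = ≤-refl
  ∧≤op or  x y = ≤-trans (x∧y≤x x y) (x≤x∨y x y)
  ∧≤op imp x y = ≤-trans (x∧y≤y x y) (y≤x∨y (∼ x) y)

  -- Used to compute the inconsistency of a Ciore value: `x ∧ (x ⇒ i)` is only `x ∧ i` in general,
  -- and equals `i` once `i` lies below `x`.
  ∧∧∧≤op : ∀ # x x′ y y′ → (x ∧ x′) ∧ (y ∧ y′) ≤ op # x y
  ∧∧∧≤op # x x′ y y′ = ≤-trans
    (∧-greatest (≤-trans (x∧y≤x _ _) (x∧y≤x x x′)) (≤-trans (x∧y≤y _ _) (x∧y≤x y y′)))
    (∧≤op # x y)

-- Valuations attaining prescribed values.

module Valuations (𝓑 : PairMultialgebra c ℓ r s) where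
  open PairMultialgebra 𝓑

  -- Distinct connectives occur in distinct formulas, so values of each p₀ # p₁ and
  -- each # p₀ can be prescribed independently.
  module Prescribed (ρ : ℕ → B)
                    (bins : ∀ # → Satisfiable (bin⟦ # ⟧ (ρ 0) (ρ 1)))
                    (uns : ∀ # → Satisfiable (un⟦ # ⟧ (ρ 0))) where

    value      : Formula → B
    choose-bin : ∀ # α β → Satisfiable (bin⟦ # ⟧ (value α) (value β))
    choose-un  : ∀ # α → Satisfiable (un⟦ # ⟧ (value α))

    value (var n)     = ρ n
    value (bin # α β) = proj₁ (choose-bin # α β)
    value (un # α)    = proj₁ (choose-un # α)

    -- `value` computes to `ρ 0` and `ρ 1` on the two variables, so `bins #` has the required type;
    -- every other formula takes an arbitrary witness of nonemptiness.
    choose-bin # (var 0) (var 1) = bins #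
    choose-bin # α       β       = bin-nonempty # (value α) (value β)

    choose-un # (var 0) = uns #
    choose-un # α       = un-nonempty # (value α)

    valuation : Valuation nmatrix
    valuation = record
      { val     = value
      ; val-bin = λ # α β → proj₂ (choose-bin # α β)
      ; val-un  = λ # α → proj₂ (choose-un # α)
      }

  assign : B → B → ℕ → B
  assign z w zero    = z
  assign z w (suc _) = w

  bin-attained : ∀ # z w {u} → u ∈ bin⟦ # ⟧ z w →
    Σ[ v ∈ Valuation nmatrix ] let open Valuation v in
      val (var 0) ≡ z × val (var 1) ≡ w × val (bin # (var 0) (var 1)) ≡ u
  bin-attained # z w {u} u∈ =
    Prescribed.valuation (assign z w) (proj₁ (prescribe # u∈)) (λ ⋆ → un-nonempty ⋆ z)
    , ≡.refl , ≡.refl , proj₂ (prescribe # u∈)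
    where
    -- Splitting on `#` lets the chosen function reduce at that connective, so that its value there
    -- is `u` by `≡.refl`.
    prescribe : ∀ # → u ∈ bin⟦ # ⟧ z w →
      Σ[ f ∈ (∀ ⋆ → Satisfiable (bin⟦ ⋆ ⟧ z w)) ] proj₁ (f #) ≡ u
    prescribe and u∈ = (λ { and → u , u∈ ; ⋆ → bin-nonempty ⋆ z w }) , ≡.refl
    prescribe or  u∈ = (λ { or  → u , u∈ ; ⋆ → bin-nonempty ⋆ z w }) , ≡.refl
    prescribe imp u∈ = (λ { imp → u , u∈ ; ⋆ → bin-nonempty ⋆ z w }) , ≡.refl

  neg-attained : ∀ z {u} → u ∈ un⟦ neg ⟧ z →
    Σ[ v ∈ Valuation nmatrix ] let open Valuation v in
      val (var 0) ≡ z × val (¬ᶠ var 0) ≡ u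
  neg-attained z {u} u∈ =
    Prescribed.valuation (assign z z) (λ ⋆ → bin-nonempty ⋆ z z)
      (λ { neg → u , u∈ ; ⋆ → un-nonempty ⋆ z })
    , ≡.refl , ≡.refl

  -- Any element with pair `p` is equal to the witness `u`, whose pair is also `p`, so membership
  -- passes to it from `u`.
  ≐-⟪⟫ : ∀ {S : Pred B s} {p} → Satisfiable S → S Respects (Setoid._≈_ domain) →
         S ⊆ ⟪ p ⟫ → S ≐ ⟪ p ⟫
  ≐-⟪⟫ (u , u∈S) resp S⊆p =
    S⊆p , λ { (w₁≈p₁ , w₂≈p₂) → let u₁≈p₁ , u₂≈p₂ = S⊆p u∈S in
      resp (trans u₁≈p₁ (sym w₁≈p₁) , trans u₂≈p₂ (sym w₂≈p₂)) u∈S }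

axiom : BinOp → Ax′
axiom and = ax-∧
axiom or  = ax-∨
axiom imp = ax-→

propagation : BinOp → Formula → Formula → Formula
propagation # α β = (∘ᶠ α ∨ᶠ ∘ᶠ β) ↔ᶠ ∘ᶠ bin # α β

inst-propagation : ∀ # α β → propagation # α β ∈ Instance (axiom #)
inst-propagation and = inst-∧
inst-propagation or  = inst-∨
inst-propagation imp = inst-→

-- Designation of the axioms over a swap structure for Ci.

module CiSemantics (𝓑 : PairMultialgebra c ℓ r s) (𝓑∈Ci : 𝓑 ∈ 𝕂Ci) where
  open PairMultialgebra 𝓑
  open IsCi 𝓑∈Ci
  open BooleanLemmas 𝒜

  inconsistency : B → A
  inconsistency z = fst z ∧ snd z

  module _ (v : Valuation nmatrix) where
    open Valuation v
    open Nmatrix nmatrix using (Designated)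

    fst-bin : ∀ # α β → fst (val (bin # α β)) ≈ op # (fst (val α)) (fst (val β))
    fst-bin # α β = bin-val # (val α) (val β) (val-bin # α β)

    fst-circ : ∀ α → fst (val (∘ᶠ α)) ≈ ∼ inconsistency (val α)
    fst-circ α = proj₁ (proj₁ (circ-val (val α)) (val-un circ α))

    →ᶠ-designated : ∀ α β → val (α →ᶠ β) ∈ Designated ⇔ fst (val α) ≤ fst (val β)
    →ᶠ-designated α β = ⇒-⊤⇔≤ ⇔-∘ ≈-⇔ (fst-bin imp α β) refl

    ↔ᶠ-designated : ∀ α β → val (α ↔ᶠ β) ∈ Designated ⇔ fst (val α) ≈ fst (val β)
    ↔ᶠ-designated α β = biconditional-⊤⇔≈ ⇔-∘ ≈-⇔
      (trans (fst-bin and (α →ᶠ β) (β →ᶠ α))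
             (∧-cong (fst-bin imp α β) (fst-bin imp β α)))
      refl

    propagation-designated : ∀ # α β → val (propagation # α β) ∈ Designated ⇔
      inconsistency (val α) ∧ inconsistency (val β) ≈ inconsistency (val (bin # α β))
    propagation-designated # α β =
      ∼-∨-∼≈∼⇔ ⇔-∘ (≈-⇔ fst-∘∨∘ (fst-circ γ) ⇔-∘ ↔ᶠ-designated (∘ᶠ α ∨ᶠ ∘ᶠ β) (∘ᶠ γ))
      where
      γ = bin # α β

      fst-∘∨∘ : fst (val (∘ᶠ α ∨ᶠ ∘ᶠ β))
                ≈ ∼ inconsistency (val α) ∨ ∼ inconsistency (val β)
      fst-∘∨∘ = trans (fst-bin or (∘ᶠ α) (∘ᶠ β)) (∨-cong (fst-circ α) (fst-circ β))

  -- From the Ciore operations to validity of the axioms.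

  module _ (ciore : HasCioreOperations 𝓑) where
    open HasCioreOperations ciore

    inconsistency-bin : ∀ # {z w u} → u ∈ bin⟦ # ⟧ z w →
      inconsistency z ∧ inconsistency w ≈ inconsistency u
    inconsistency-bin # {z} {w} {u} u∈ = begin
      -- The inequality unfolds to the equation `i ≈ i ∧ x`.
      i            ≈⟨ ∧∧∧≤op # (fst z) (snd z) (fst w) (snd w) ⟩
      i ∧ x        ≈⟨ ∧-comm i x ⟩
      x ∧ i        ≈⟨ ∧-⇒ x i ⟨
      x ∧ (x ⇒ i)  ≈⟨ ∧-cong u₁≈ u₂≈ ⟨
      inconsistency u ∎
      where
      open SetoidReasoning setoid
      i = inconsistency z ∧ inconsistency w
      x = op # (fst z) (fst w)
      u₁≈ = proj₁ (proj₁ (bin-det # z w) u∈)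
      u₂≈ = proj₂ (proj₁ (bin-det # z w) u∈)

    validates-propagation : ∀ # α β (v : Valuation nmatrix) →
      Valuation.val v (propagation # α β) ∈ Nmatrix.Designated nmatrix
    validates-propagation # α β v =
      from (propagation-designated v # α β) (inconsistency-bin # (val-bin # α β))
      where open Valuation v

    validatesAx′ : 𝓑 ∈ ValidatesAx′
    validatesAx′ ax-¬¬ _ (inst-¬¬ α) v =
      -- Ciore negation swaps components, so negating twice restores the first one.
      from (→ᶠ-designated v α (¬ᶠ ¬ᶠ α)) (≤-reflexive (sym (trans
        (proj₁ (proj₁ (neg-det (val (¬ᶠ α))) (val-un neg (¬ᶠ α))))
        (proj₂ (proj₁ (neg-det (val α)) (val-un neg α))))))
      where open Valuation v
    validatesAx′ ax-∧ _ (inst-∧ α β) = validates-propagation and α β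
    validatesAx′ ax-∨ _ (inst-∨ α β) = validates-propagation or α β
    validatesAx′ ax-→ _ (inst-→ α β) = validates-propagation imp α β

  -- From validity of the axioms to the Ciore operations.

  module _ (valid : 𝓑 ∈ ValidatesAx′) where
    open Valuations 𝓑

    bin⊆ : ∀ # z w → bin⟦ # ⟧ z w ⊆
      ⟪ op # (fst z) (fst w)
      , (op # (fst z) (fst w) ⇒ (inconsistency z ∧ inconsistency w)) ⟫
    bin⊆ # z w {u} u∈ with bin-attained # z w u∈
    -- Matching turns `z`, `w`, `u` into values under `v`, so the schema validated at `v` speaks of
    -- the inconsistency of `u`.
    ... | v , ≡.refl , ≡.refl , ≡.refl = u₁≈ , (begin
      snd u                           ≈⟨ ∨≈⊤⇒snd-determined (dom-⊤ u) ⟩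
      fst u ⇒ inconsistency u         ≈⟨ ∨-cong (¬-cong u₁≈) (sym propagated) ⟩
      op # (fst z) (fst w) ⇒ (inconsistency z ∧ inconsistency w) ∎)
      where
      open SetoidReasoning setoid
      u₁≈ = bin-val # z w u∈
      propagated = to (propagation-designated v # (var 0) (var 1))
        (valid (axiom #) _ (inst-propagation # (var 0) (var 1)) v)

    -- Membership in Ci gives `snd u ≤ fst z`. Conversely, validity puts `fst z` below the first
    -- component of the value of `¬ᶠ ¬ᶠ var 0`, which is `snd u` whichever element of the negation
    -- of `u` is chosen.
    neg⊆ : ∀ z → un⟦ neg ⟧ z ⊆ ⟪ snd z , fst z ⟫
    neg⊆ z {u} u∈ with neg-attained z u∈
    ... | v , ≡.refl , ≡.refl = u₁≈z₂ , antisym u₂≤z₁ (≤-trans z₁≤¬¬ (≤-reflexive ¬¬≈u₂))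
      where
      open Valuation v
      u₁≈z₂ = proj₁ (neg-val z u∈)
      u₂≤z₁ = proj₂ (neg-val z u∈)
      z₁≤¬¬ = to (→ᶠ-designated v (var 0) (¬ᶠ ¬ᶠ var 0))
        (valid ax-¬¬ _ (inst-¬¬ (var 0)) v)
      ¬¬≈u₂ = proj₁ (neg-val u (val-un neg (¬ᶠ var 0)))

    hasCioreOperations : HasCioreOperations 𝓑
    hasCioreOperations = record
      { bin-det  = λ # z w → ≐-⟪⟫ (bin-nonempty # z w) (bin-resp # z w) (bin⊆ # z w)
      ; neg-det  = λ z → ≐-⟪⟫ (un-nonempty neg z) (un-resp neg z) (neg⊆ z)
      ; circ-det = circ-val
      }

proposition9p20 : ∀ {c ℓ r s : Level} →
    𝕂Ciore {c} {ℓ} {r} {s} ≐ (λ 𝓑 → 𝓑 ∈ 𝕂Ci × 𝓑 ∈ ValidatesAx′)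
proposition9p20 =
    (λ {𝓑} (ci , ciore) → ci , CiSemantics.validatesAx′ 𝓑 ci ciore)
  , (λ {𝓑} (ci , valid) → ci , CiSemantics.hasCioreOperations 𝓑 ci valid)
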